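{- Let $\varepsilon:\mathcal{K}_2\to 2^\omega$ be the applicative morphism given by the function $\varepsilon(\alpha)([n,m])=1$ if $\alpha(n)=m$ and $\varepsilon(\alpha)([n,m])=0$ otherwise, and let $\zeta:2^\omega\to\mathcal{K}_2$ be the applicative morphism given by the inclusion of $\{0,1\}^{\mathbb{N}}$ in $\mathbb{N}^{\mathbb{N}}$. Then $\varepsilon$ and $\zeta$ give an equivalence between the pcas $2^\omega$ and $\mathcal{K}_2$; that is, $\zeta\circ\varepsilon\simeq\mathrm{id}_{\mathcal{K}_2}$ and $\varepsilon\circ\zeta\simeq\mathrm{id}_{2^\omega}$.
   Context: A partial combinatory algebra (pca) is a set $\mathcal{A}$ with a partial binary application $(a,b)\mapsto ab$ (associating to the left) such that there are $\mathsf{k},\mathsf{s}\in\mathcal{A}$ with, for all $a,b,c$: $\mathsf{k}ab=a$; $\mathsf{s}ab$ is defined; and whenever $(ac)(bc)$ is defined, $\mathsf{s}abc$ is defined and equals $(ac)(bc)$. An applicative morphism $\gamma:\mathcal{A}\to\mathcal{B}$ of pcas assigns to every $a\in\mathcal{A}$ a nonempty subset $\gamma(a)\subseteq\mathcal{B}$ such that there is $r\in\mathcal{B}$ with: whenever $aa'$ is defined in $\mathcal{A}$, $b\in\gamma(a)$, $b'\in\gamma(a')$, then $rbb'$ is defined and lies in $\gamma(aa')$. A function is regarded as a single-valued relation. Composition is composition of relations. For $\gamma,\delta:\mathcal{A}\to\mathcal{B}$, $\gamma\leq\delta$ means there is $s\in\mathcal{B}$ such that for all $a\in\mathcal{A}$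 and $b\in\gamma(a)$, $sb$ is defined and $sb\in\delta(a)$; $\gamma\simeq\delta$ means $\gamma\leq\delta$ and $\delta\leq\gamma$. Below $[\cdot,\cdot]$ is a standard bijective pairing on $\mathbb{N}$ and $[\cdot,\ldots,\cdot]$ a standard coding of finite sequences of natural numbers by natural numbers. $\mathcal{K}_2$ (Kleene's second model): underlying set $\mathbb{N}^{\mathbb{N}}$; $\alpha\beta$ is defined iff for every $n$ there is $k$ with $\alpha([n,\beta(0),\ldots,\beta(k-1)])>0$, and then $(\alpha\beta)(n)=\alpha([n,\beta(0),\ldots,\beta(k-1)])-1$ for the least such $k$. $2^\omega$: underlying set $\{0,1\}^{\mathbb{N}}$; $\alpha\cdot\beta$ is defined iff for every $n$ there is $k$ with $\alpha([n,\beta(0),\ldots,\beta(k-1)])=1$, and then $(\alpha\cdot\beta)(n)=\alpha([n,\beta(0),\ldots,\beta(k)])$ for the least such $k$. -}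

module Defs where

open import Data.Empty using (⊥)
open import Data.Fin.Base using (Fin; zero; suc; toℕ)
open import Data.Fin.Patterns using (0F; 1F)
open import Data.List.Base using (List; []; _∷_; map; length; take; applyUpTo)
open import Data.List.Properties
  using (length-map; length-take; length-applyUpTo; map-applyUpTo)
open import Data.Maybe.Base using (Maybe; just; nothing; maybe; _>>=_; _<∣>_)
open import Data.Maybe.Relation.Unary.All using (All; just; nothing)
open import Data.Nat.Base
  using (ℕ; zero; suc; _∸_; _≤_; _<_; _>_; _⊔_; z≤n; s≤s; s≤s⁻¹; z<s)
open import Data.Nat.Properties
  using (_≟_; _≤?_; ≤-refl; ≤-reflexive; ≤-trans; m≤n⇒m≤1+n; <⇒≱; ≮⇒≥; m≤m⊔n; m≤n⊔m; m⊓n≤n)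
open import Data.Product.Base using (∃; ∃-syntax; _×_; _,_; proj₁; proj₂)
open import Function.Base using (_∘_; id)
open import Function.Bundles
  using (_⇔_; mk⇔; _↔_; _↪_; mk↪; module Equivalence; module Inverse; module RightInverse)
open import Function.Construct.Identity using (↪-id)
open import Level using (Level; 0ℓ) renaming (suc to lsuc; _⊔_ to _⊔ˡ_)
open import Relation.Binary.Core using (Rel; REL)
open import Relation.Binary.PropositionalEquality
  using (_≡_; _≗_; refl; sym; trans; cong; cong₂; subst)
open import Relation.Binary.Structures using (IsEquivalence)
open import Relation.Nullary.Decidable.Core using (Dec; yes; no)
open import Relation.Nullary.Negation.Core using (contradiction)

private variable
  a b c ℓ ℓ₁ ℓ₂ ℓ₃ r₁ r₂ : Level

-- Carriers are setoids, so that elements of function spaces can be compared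
-- pointwise.  The partial application is given by its graph: a · b ↦ c says
-- that ab is defined and equal to c.
record PCA (c ℓ : Level) : Set (lsuc (c ⊔ˡ ℓ)) where
  infix 4 _≈_ _·_↦_
  field
    Carrier       : Set c
    _≈_           : Rel Carrier ℓ
    isEquivalence : IsEquivalence _≈_
    _·_↦_         : Carrier → Carrier → Carrier → Set ℓ
    ·-resp-≈      : ∀ {x x′ y y′ z z′} → x ≈ x′ → y ≈ y′ → z ≈ z′ →
                    x · y ↦ z → x′ · y′ ↦ z′
    ·-functional  : ∀ {x y z z′} → x · y ↦ z → x · y ↦ z′ → z ≈ z′
    k s           : Carrier
    k-law         : ∀ x y → ∃[ u ] (k · x ↦ u × u · y ↦ x)
    s-defined     : ∀ x y → ∃[ u ] ∃[ v ] (s · x ↦ u × u · y ↦ v)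
    s-law         : ∀ {x y z p q w} → x · z ↦ p → y · z ↦ q → p · q ↦ w →
                    ∃[ u ] ∃[ v ] (s · x ↦ u × u · y ↦ v × v · z ↦ w)

  open IsEquivalence isEquivalence public
    renaming (refl to ≈-refl; sym to ≈-sym; trans to ≈-trans)

module _ (A : PCA a ℓ₁) (B : PCA b ℓ₂) where
  private
    module A = PCA A
    module B = PCA B

  -- rel x y expresses y ∈ γ(x).
  record ApplicativeMorphism (r : Level) : Set (a ⊔ˡ ℓ₁ ⊔ˡ b ⊔ˡ ℓ₂ ⊔ˡ lsuc r) where
    field
      rel      : REL A.Carrier B.Carrier r
      resp-≈   : ∀ {x x′ y y′} → x A.≈ x′ → y B.≈ y′ → rel x y → rel x′ y′
      nonempty : ∀ x → ∃[ y ] rel x y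
      realizer : B.Carrier
      realizes : ∀ {x x′ x″ y y′} → x A.· x′ ↦ x″ → rel x y → rel x′ y′ →
                 ∃[ u ] ∃[ v ] (realizer B.· y ↦ u × u B.· y′ ↦ v × rel x″ v)

open ApplicativeMorphism using (rel)

module _ {A : PCA a ℓ₁} {B : PCA b ℓ₂} where
  private
    module A = PCA A
    module B = PCA B

  infix 4 _≼_ _≃_

  _≼_ : ApplicativeMorphism A B r₁ → ApplicativeMorphism A B r₂ → Set _
  γ ≼ δ = ∃[ t ] (∀ x y → rel γ x y → ∃[ z ] (t B.· y ↦ z × rel δ x z))

  _≃_ : ApplicativeMorphism A B r₁ → ApplicativeMorphism A B r₂ → Set _
  γ ≃ δ = γ ≼ δ × δ ≼ γ

  -- A function, regarded as the single-valued relation x ↦ { f x }.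
  fromFunction :
    (f : A.Carrier → B.Carrier) →
    (∀ {x x′} → x A.≈ x′ → f x B.≈ f x′) →
    (∃[ t ] (∀ x x′ x″ → x A.· x′ ↦ x″ →
             ∃[ u ] (t B.· f x ↦ u × u B.· f x′ ↦ f x″))) →
    ApplicativeMorphism A B ℓ₂
  fromFunction f f-cong (t , h) = record
    { rel      = λ x y → y B.≈ f x
    ; resp-≈   = λ x≈ y≈ e → B.≈-trans (B.≈-sym y≈) (B.≈-trans e (f-cong x≈))
    ; nonempty = λ x → f x , B.≈-refl
    ; realizer = t
    ; realizes = λ d e e′ → let (u , p , q) = h _ _ _ d in
        u , _ , B.·-resp-≈ B.≈-refl (B.≈-sym e) B.≈-refl p
              , B.·-resp-≈ B.≈-refl (B.≈-sym e′) B.≈-refl q , B.≈-refl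
    }

idᵐ : (A : PCA a ℓ) → ApplicativeMorphism A A ℓ
idᵐ A = fromFunction id id (i , λ x _ _ d → x , i-law x , d)
  where
  open PCA A
  i : Carrier
  i = let (_ , v , _) = s-defined k k in v
  i-law : ∀ x → i · x ↦ x
  i-law x =
    let (u , p , _) = k-law x x
        (w , p′ , q′) = k-law x u
        (_ , _ , m , n) = s-defined k k
        (_ , _ , m′ , n′ , o) = s-law p′ p q′
        e = ·-functional m′ m
        e′ = ·-functional (·-resp-≈ e ≈-refl ≈-refl n′) n
    in ·-resp-≈ e′ ≈-refl ≈-refl o

infixr 9 _∘ᵐ_
_∘ᵐ_ : {A : PCA a ℓ₁} {B : PCA b ℓ₂} {C : PCA c ℓ₃} →
       ApplicativeMorphism B C r₂ → ApplicativeMorphism A B r₁ →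
       ApplicativeMorphism A C (b ⊔ˡ r₁ ⊔ˡ r₂)
_∘ᵐ_ {A = A} {B = B} {C = C} δ γ = record
  { rel      = λ x z → ∃[ y ] (γ.rel x y × δ.rel y z)
  ; resp-≈   = λ x≈ z≈ (y , p , q) → y , γ.resp-≈ x≈ B.≈-refl p , δ.resp-≈ B.≈-refl z≈ q
  ; nonempty = λ x → let (y , p) = γ.nonempty x ; (z , q) = δ.nonempty y in z , y , p , q
  ; realizer = t
  ; realizes = λ d (_ , p , q) (_ , p′ , q′) →
      let (_ , _ , f , g , h) = γ.realizes d p p′
          (_ , _ , f₁ , g₁ , h₁) = δ.realizes f ρ∈ q
          (_ , _ , f₂ , g₂ , h₂) = δ.realizes g h₁ q′
          (_ , k₁ , k₂) = C.k-law δ.realizer _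
          e = C.·-functional f₁ r′ρ
          (_ , _ , m , n , o) = C.s-law k₂ (C.·-resp-≈ e C.≈-refl C.≈-refl g₁) f₂
          m≈ = C.·-functional (C.·-resp-≈ C.≈-refl (C.·-functional k₁ kr′) C.≈-refl m) m₀
          n≈ = C.·-functional (C.·-resp-≈ m≈ C.≈-refl C.≈-refl n) n₀
      in _ , _ , C.·-resp-≈ n≈ C.≈-refl C.≈-refl o , g₂ , _ , h , h₂
  }
  where
  module A = PCA A
  module B = PCA B
  module C = PCA C
  module γ = ApplicativeMorphism γ
  module δ = ApplicativeMorphism δ

  -- With ρ ∈ δ(r), the composite is realized by t = s (k r′) (r′ ρ).
  ρ+ : ∃[ z ] δ.rel γ.realizer z
  ρ+ = δ.nonempty γ.realizer
  ρ∈ : δ.rel γ.realizer (proj₁ ρ+)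
  ρ∈ = proj₂ ρ+

  r′ρ+ : ∃[ w ] (δ.realizer C.· proj₁ ρ+ ↦ w)
  r′ρ+ =
    let (_ , kk , _) = A.k-law A.k A.k
        (y , p) = γ.nonempty A.k
        (_ , _ , f , _ , _) = γ.realizes kk p p
        (z , q) = δ.nonempty y
        (w , _ , g , _ , _) = δ.realizes f ρ∈ q
    in w , g
  r′ρ : δ.realizer C.· proj₁ ρ+ ↦ proj₁ r′ρ+
  r′ρ = proj₂ r′ρ+

  kr′+ : ∃[ w ] (C.k C.· δ.realizer ↦ w)
  kr′+ = let (w , p , _) = C.k-law δ.realizer δ.realizer in w , p
  kr′ : C.k C.· δ.realizer ↦ proj₁ kr′+
  kr′ = proj₂ kr′+

  t+ : ∃[ u ] ∃[ v ] (C.s C.· proj₁ kr′+ ↦ u × u C.· proj₁ r′ρ+ ↦ v)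
  t+ = C.s-defined (proj₁ kr′+) (proj₁ r′ρ+)
  t : C.Carrier
  t = proj₁ (proj₂ t+)
  m₀ : C.s C.· proj₁ kr′+ ↦ proj₁ t+
  m₀ = proj₁ (proj₂ (proj₂ t+))
  n₀ : proj₁ t+ C.· proj₁ r′ρ+ ↦ t
  n₀ = proj₂ (proj₂ (proj₂ t+))

Least : (ℕ → Set) → ℕ → Set
Least P k = P k × (∀ j → P j → k ≤ j)

-- A coding of finite sequences comes with a decoding function that inverts it
-- on codes; it need not be surjective.
module Application (coding : List ℕ ↪ ℕ) where
  open RightInverse coding using () renaming (to to encode)

  infix 6 [_⨾_↾_]

  -- [ n ⨾ β ↾ k ] codes the sequence n, β(0), …, β(k-1).
  [_⨾_↾_] : ℕ → (ℕ → ℕ) → ℕ → ℕ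
  [ n ⨾ β ↾ k ] = encode (n ∷ applyUpTo β k)

  -- In both cases the result exists exactly when a suitable k exists for every
  -- n, since the condition on k is decidable.
  AppK₂ : (α β γ : ℕ → ℕ) → Set
  AppK₂ α β γ = ∀ n → ∃[ k ]
    (Least (λ k → α [ n ⨾ β ↾ k ] > 0) k × γ n ≡ α [ n ⨾ β ↾ k ] ∸ 1)

  App2^ω : (α β γ : ℕ → Fin 2) → Set
  App2^ω α β γ = ∀ n → ∃[ k ]
    (Least (λ k → α [ n ⨾ toℕ ∘ β ↾ k ] ≡ 1F) k × γ n ≡ α [ n ⨾ toℕ ∘ β ↾ suc k ])

-- m ⊑ v: if the computation m has an answer, it is v.
infix 4 _⊑_
_⊑_ : {X : Set} → Maybe X → X → Set
m ⊑ v = All (_≡ v) m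

Eventually : (ℕ → Set) → Set
Eventually P = ∃[ N ] (∀ k → N ≤ k → P k)

Halts : {X : Set} → (ℕ → Maybe X) → X → Set
Halts τ v = ∃[ K ] (τ K ≡ just v × (∀ j → j < K → τ j ≡ nothing))

-- Search for a halting stage with bounded fuel, given partial knowledge σ of
-- the stages τ.
run : {X : Set} → ℕ → (ℕ → Maybe (Maybe X)) → Maybe X
run zero    σ = nothing
run (suc f) σ = σ 0 >>= (_<∣> run f (σ ∘ suc))

infix 4 _⇒_
record _⇒_ {X : Set} (A : ℕ → ℕ → Maybe X) (α : ℕ → X) : Set where
  field
    sound : ∀ k x → A k x ⊑ α x
    conv  : ∀ x → Eventually (λ k → A k x ≡ just (α x))
open _⇒_ public

lookupᵐ : {X : Set} → List X → ℕ → Maybe X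
lookupᵐ []       i       = nothing
lookupᵐ (x ∷ xs) zero    = just x
lookupᵐ (x ∷ xs) (suc i) = lookupᵐ xs i

module _ {X : Set} where

  ⊑-just : {m : Maybe X} {v w : X} → m ⊑ v → m ≡ just w → w ≡ v
  ⊑-just (just e) refl = e

  ⊑-refl : {m : Maybe X} {v : X} → m ≡ just v → m ⊑ v
  ⊑-refl refl = just refl

  ⊑-bind : {Y : Set} {m : Maybe Y} {f : Y → Maybe X} {u : Y} {v : X} →
           m ⊑ u → f u ⊑ v → (m >>= f) ⊑ v
  ⊑-bind nothing     q = nothing
  ⊑-bind (just refl) q = q

  ≡-bind : {Y : Set} {m : Maybe Y} (f : Y → Maybe X) {u : Y} {v : X} →
           m ≡ just u → f u ≡ just v → (m >>= f) ≡ just v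
  ≡-bind f refl q = q

  ⊑-fun : {Y : Set} {m : Maybe Y} (g : Y → X) {u : Y} → m ⊑ u → (m >>= λ y → just (g y)) ⊑ g u
  ⊑-fun g p = ⊑-bind p (just refl)

  run-sound : ∀ f {σ : ℕ → Maybe (Maybe X)} {τ v} →
              (∀ j → σ j ⊑ τ j) → Halts τ v → run f σ ⊑ v
  run-sound zero    p h = nothing
  run-sound (suc f) {σ} {τ} {v} p h = ⊑-bind (p 0) (go h)
    where
    go : Halts τ v → (τ 0 <∣> run f (σ ∘ suc)) ⊑ v
    go (zero  , e , l) rewrite e = just refl
    go (suc K , e , l) rewrite l 0 z<s =
      run-sound f (p ∘ suc) (K , e , λ j j<K → l (suc j) (s≤s j<K))

  run-conv : ∀ f {σ : ℕ → Maybe (Maybe X)} {τ v} → ((K , _) : Halts τ v) → K < f →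
             (∀ j → j ≤ K → σ j ≡ just (τ j)) → run f σ ≡ just v
  run-conv (suc f) (zero , e , l) K<f p rewrite p 0 z≤n | e = refl
  run-conv (suc f) (suc K , e , l) K<f p rewrite p 0 z≤n | l 0 z<s =
    run-conv f (K , e , λ j j<K → l (suc j) (s≤s j<K)) (s≤s⁻¹ K<f) (λ j j≤K → p (suc j) (s≤s j≤K))

  Halts-unique : ∀ {τ : ℕ → Maybe X} {v w} → Halts τ v → Halts τ w → v ≡ w
  Halts-unique {τ} h@(K , _) h′ =
    ⊑-just (run-sound (suc K) {just ∘ τ} (λ _ → just refl) h′) (run-conv (suc K) h ≤-refl (λ _ _ → refl))

  halts : ∀ (τ : ℕ → Maybe X) k {v} → τ k ≡ just v → ∃ (Halts τ)
  halts τ zero    e = _ , zero , e , λ _ ()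
  halts τ (suc k) e with τ 0 in e₀
  ... | just u  = u , zero , e₀ , λ _ ()
  ... | nothing =
    let (w , K , p , l) = halts (τ ∘ suc) k e in
    w , suc K , p , λ { zero _ → e₀ ; (suc j) j<K → l j (s≤s⁻¹ j<K) }

  lookup-⇒ : (β : ℕ → X) → (λ k → lookupᵐ (applyUpTo β k)) ⇒ β
  lookup-⇒ β = record { sound = snd β ; conv = λ x → suc x , cnv β x }
    where
    snd : ∀ β k x → lookupᵐ (applyUpTo β k) x ⊑ β x
    snd β zero    x       = nothing
    snd β (suc k) zero    = just refl
    snd β (suc k) (suc x) = snd (β ∘ suc) k x
    cnv : ∀ β x k → x < k → lookupᵐ (applyUpTo β k) x ≡ just (β x)
    cnv β zero    (suc k) _   = refl
    cnv β (suc x) (suc k) x<k = cnv (β ∘ suc) x k (s≤s⁻¹ x<k)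

  take-applyUpTo : ∀ (f : ℕ → X) {m n} → m ≤ n → take m (applyUpTo f n) ≡ applyUpTo f m
  take-applyUpTo f z≤n       = refl
  take-applyUpTo f (s≤s m≤n) = cong (f 0 ∷_) (take-applyUpTo (f ∘ suc) m≤n)

  applyUpTo-cong : ∀ {f g : ℕ → X} → f ≗ g → ∀ n → applyUpTo f n ≡ applyUpTo g n
  applyUpTo-cong e zero    = refl
  applyUpTo-cong e (suc n) = cong₂ _∷_ (e 0) (applyUpTo-cong (e ∘ suc) n)

ev-map : {P Q : ℕ → Set} → (∀ k → P k → Q k) → Eventually P → Eventually Q
ev-map f (N , p) = N , λ k h → f k (p k h)

ev-zip : {P Q R : ℕ → Set} → (∀ k → P k → Q k → R k) → Eventually P → Eventually Q → Eventually R
ev-zip f (M , p) (N , q) =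
  M ⊔ N , λ k h → f k (p k (≤-trans (m≤m⊔n M N) h)) (q k (≤-trans (m≤n⊔m M N) h))

ev-all : {P : ℕ → ℕ → Set} → (∀ j → Eventually (P j)) → ∀ K → Eventually (λ k → ∀ j → j ≤ K → P j k)
ev-all e zero    = ev-map (λ { k p zero _ → p }) (e zero)
ev-all e (suc K) =
  ev-zip (λ { k p q zero _ → p ; k p q (suc j) j≤K → q j (s≤s⁻¹ j≤K) }) (e zero) (ev-all (e ∘ suc) K)

run-⇒ : {X : Set} {σ : ℕ → ℕ → ℕ → Maybe (Maybe X)} {τ : ℕ → ℕ → Maybe X} {γ : ℕ → X} →
        (∀ x → (λ k j → σ k x j) ⇒ τ x) → (∀ x → Halts (τ x) (γ x)) →
        (λ k x → run k (σ k x)) ⇒ γ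
run-⇒ p h = record
  { sound = λ k x → run-sound k (sound (p x) k) (h x)
  ; conv  = λ x → let K = proj₁ (h x) in
      ev-zip (λ k l q → run-conv k (h x) l q) (suc K , λ _ l → l) (ev-all (conv (p x)) K)
  }

-- Both models are instances of one scheme: αβ(n) is found by applying step to
-- the values of α at [n,β(0),…,β(k-1)] and [n,β(0),…,β(k)] for k = 0, 1, …
-- until an answer appears; emit produces elements α with prescribed answers.

module Scheme
  (coding : List ℕ ↪ ℕ) {D : Set} (embedding : D ↪ ℕ)
  (step : D → D → Maybe D) (emit : Maybe D → Maybe D → D)
  (step-emit : ∀ v w → step (emit nothing (just v)) (emit (just v) w) ≡ just v)
  (step-wait : ∀ w → step (emit nothing nothing) w ≡ nothing)
  where

  open Application coding
  open RightInverse coding using () renaming (to to encode; from to decode; strictlyInverseʳ to decode-encode)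
  open RightInverse embedding using () renaming (to to ι; from to ρ; strictlyInverseʳ to ρ-ι)

  query : (α β : ℕ → D) → ℕ → ℕ → D
  query α β n k = α [ n ⨾ ι ∘ β ↾ k ]

  stage : (α β : ℕ → D) → ℕ → ℕ → Maybe D
  stage α β n k = step (query α β n k) (query α β n (suc k))

  App : (α β γ : ℕ → D) → Set
  App α β γ = ∀ n → Halts (stage α β n) (γ n)

  query-cong : ∀ {α α′ β β′} → α ≗ α′ → β ≗ β′ → ∀ n k → query α β n k ≡ query α′ β′ n k
  query-cong {α′ = α′} p q n k =
    trans (p _) (cong (λ l → α′ (encode (n ∷ l))) (applyUpTo-cong (λ i → cong ι (q i)) k))

  App-resp : ∀ {α α′ β β′ γ γ′} → α ≗ α′ → β ≗ β′ → γ ≗ γ′ → App α β γ → App α′ β′ γ′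
  App-resp p q r h n =
    let (K , e , l) = h n
        eq = λ j → cong₂ step (query-cong p q n j) (query-cong p q n (suc j))
    in K , trans (sym (eq K)) (trans e (cong just (r n))) , λ j j<K → trans (sym (eq j)) (l j j<K)

  App-functional : ∀ {α β γ γ′} → App α β γ → App α β γ′ → γ ≗ γ′
  App-functional h h′ n = Halts-unique (h n) (h′ n)

  prefixᵐ : (ℕ → Maybe D) → ℕ → Maybe (List ℕ)
  prefixᵐ B zero    = just []
  prefixᵐ B (suc j) = B 0 >>= λ d → prefixᵐ (B ∘ suc) j >>= λ l → just (ι d ∷ l)

  queryᵐ : (A B : ℕ → Maybe D) → ℕ → ℕ → Maybe D
  queryᵐ A B n j = prefixᵐ B j >>= λ l → A (encode (n ∷ l))

  stageᵐ : (A B : ℕ → Maybe D) → ℕ → ℕ → Maybe (Maybe D)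
  stageᵐ A B n j = queryᵐ A B n j >>= λ u → queryᵐ A B n (suc j) >>= λ w → just (step u w)

  appᵐ : ℕ → (A B : ℕ → Maybe D) → ℕ → Maybe D
  appᵐ f A B n = run f (stageᵐ A B n)

  prefix-⇒ : ∀ {B : ℕ → ℕ → Maybe D} {β} → B ⇒ β →
             (λ k → prefixᵐ (B k)) ⇒ applyUpTo (ι ∘ β)
  prefix-⇒ b = record
    { sound = λ k j → snd (sound b k) j
    ; conv  = λ j → cnv (conv b) j
    }
    where
    snd : ∀ {B : ℕ → Maybe D} {β} → (∀ i → B i ⊑ β i) → ∀ j → prefixᵐ B j ⊑ applyUpTo (ι ∘ β) j
    snd p zero    = just refl
    snd p (suc j) = ⊑-bind (p 0) (⊑-bind (snd (p ∘ suc) j) (just refl))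
    cnv : ∀ {B : ℕ → ℕ → Maybe D} {β} → (∀ i → Eventually (λ k → B k i ≡ just (β i))) →
          ∀ j → Eventually (λ k → prefixᵐ (B k) j ≡ just (applyUpTo (ι ∘ β) j))
    cnv p zero    = 0 , λ _ _ → refl
    cnv p (suc j) = ev-zip (λ k e e′ → ≡-bind _ e (≡-bind _ e′ refl)) (p 0) (cnv (p ∘ suc) j)

  query-⇒ : ∀ {A B α β} → A ⇒ α → B ⇒ β → ∀ n → (λ k j → queryᵐ (A k) (B k) n j) ⇒ query α β n
  query-⇒ a b n = record
    { sound = λ k j → ⊑-bind (sound (prefix-⇒ b) k j) (sound a k _)
    ; conv  = λ j → ev-zip (λ k e e′ → ≡-bind _ e e′) (conv (prefix-⇒ b) j) (conv a _)
    }

  app-⇒ : ∀ {A B α β γ} → A ⇒ α → B ⇒ β → App α β γ → (λ k → appᵐ k (A k) (B k)) ⇒ γ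
  app-⇒ {α = α} {β} a b h = run-⇒ (λ n → record
    { sound = λ k j → ⊑-bind (sound (query-⇒ a b n) k j)
                             (⊑-bind (sound (query-⇒ a b n) k (suc j)) (just refl))
    ; conv  = λ j → ev-zip (λ k e e′ → ≡-bind _ e (≡-bind _ e′ refl))
                           (conv (query-⇒ a b n) j) (conv (query-⇒ a b n) (suc j))
    }) h

  previous : (List D → Maybe D) → List D → Maybe D
  previous F []       = nothing
  previous F (d ∷ ds) = F (take (length ds) (d ∷ ds))

  previous-applyUpTo : ∀ F (β : ℕ → D) j → previous F (applyUpTo β (suc j)) ≡ F (applyUpTo β j)
  previous-applyUpTo F β j rewrite length-applyUpTo (β ∘ suc) j =
    cong F (take-applyUpTo β (m≤n⇒m≤1+n ≤-refl))

  body : (ℕ → List D → Maybe D) → List ℕ → D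
  body F []       = emit nothing nothing
  body F (n ∷ ns) = emit (previous (F n) (map ρ ns)) (F n (map ρ ns))

  lam : (ℕ → List D → Maybe D) → ℕ → D
  lam F x = body F (decode x)

  body-local : ∀ {F F′} ns → (∀ n l → length l ≤ length ns → F n l ≡ F′ n l) → body F ns ≡ body F′ ns
  body-local []       p = refl
  body-local {F} {F′} (n ∷ ns) p = cong₂ emit (prev (map ρ ns) len) (p n (map ρ ns) len)
    where
    len : length (map ρ ns) ≤ suc (length ns)
    len = ≤-trans (≤-reflexive (length-map ρ ns)) (m≤n⇒m≤1+n ≤-refl)
    prev : ∀ l → length l ≤ suc (length ns) → previous (F n) l ≡ previous (F′ n) l
    prev []       _ = refl
    prev (d ∷ ds) q = p n _ (≤-trans (≤-trans (≤-reflexive (length-take (length ds) (d ∷ ds)))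
                                              (m⊓n≤n (length ds) _)) q)

  lam-query : ∀ F β n j → query (lam F) β n j ≡
              emit (previous (F n) (applyUpTo β j)) (F n (applyUpTo β j))
  lam-query F β n j rewrite decode-encode (n ∷ applyUpTo (ι ∘ β) j)
                          | map-applyUpTo (ι ∘ β) ρ j
                          | applyUpTo-cong {f = ρ ∘ ι ∘ β} {g = β} (λ i → ρ-ι (β i)) j = refl

  lam-app : ∀ {F β γ} → (λ k n → F n (applyUpTo β k)) ⇒ γ → App (lam F) β γ
  lam-app {F} {β} {γ} p n = go (halts (λ k → F n (applyUpTo β k)) N (cv N ≤-refl))
    where
    N  = proj₁ (conv p n)
    cv = proj₂ (conv p n)
    go : ∃ (Halts (λ k → F n (applyUpTo β k))) → Halts (stage (lam F) β n) (γ n)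
    go (v , K , e , l) rewrite sym (⊑-just (sound p K n) e) = K , here , before
      where
      silent : ∀ j → j ≤ K → previous (F n) (applyUpTo β j) ≡ nothing
      silent zero    _   = refl
      silent (suc j) j<K = trans (previous-applyUpTo (F n) β j) (l j j<K)
      here : stage (lam F) β n K ≡ just v
      here = trans
        (cong₂ step
          (trans (lam-query F β n K) (cong₂ emit (silent K ≤-refl) e))
          (trans (lam-query F β n (suc K))
                 (cong (λ m → emit m (F n (applyUpTo β (suc K)))) (trans (previous-applyUpTo (F n) β K) e))))
        (step-emit v _)
      before : ∀ j → j < K → stage (lam F) β n j ≡ nothing
      before j j<K = trans
        (cong (λ q → step q (query (lam F) β n (suc j)))
          (trans (lam-query F β n j) (cong₂ emit (silent j (≤-trans (m≤n⇒m≤1+n ≤-refl) j<K)) (l j j<K))))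
        (step-wait _)

  -- A value of lam F at x depends only on F at sequences no longer than the
  -- one coded by x, so it can be emitted once the arguments entering F are
  -- known up to that length.
  delay : ℕ → (ℕ → List D → Maybe D) → ℕ → Maybe D
  delay k F x with length (decode x) ≤? k
  ... | yes _ = just (lam F x)
  ... | no  _ = nothing

  delay-⇒ : ∀ {F : ℕ → ℕ → List D → Maybe D} {F∞} →
            (∀ k n l → length l ≤ k → F k n l ≡ F∞ n l) → (λ k → delay k (F k)) ⇒ lam F∞
  delay-⇒ {F} {F∞} p = record { sound = snd ; conv = λ x → length (decode x) , cnv x }
    where
    agree : ∀ k x → length (decode x) ≤ k → lam (F k) x ≡ lam F∞ x
    agree k x q = body-local (decode x) (λ n l r → p k n l (≤-trans r q))
    snd : ∀ k x → delay k (F k) x ⊑ lam F∞ x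
    snd k x with length (decode x) ≤? k
    ... | yes q = just (agree k x q)
    ... | no  _ = nothing
    cnv : ∀ x k → length (decode x) ≤ k → delay k (F k) x ≡ just (lam F∞ x)
    cnv x k q with length (decode x) ≤? k
    ... | yes _ = cong just (agree k x q)
    ... | no ¬q = contradiction q ¬q

  ⇒-ext : {A A′ : ℕ → ℕ → Maybe D} {α : ℕ → D} → (∀ k x → A k x ≡ A′ k x) → A ⇒ α → A′ ⇒ α
  ⇒-ext e a = record
    { sound = λ k x → subst (_⊑ _) (e k x) (sound a k x)
    ; conv  = λ x → ev-map (λ k p → trans (sym (e k x)) p) (conv a x)
    }

  -- lam₂ G α abstracts over one argument, given the argument α; lam₁₂ G
  -- abstracts over both.  G sees prefixes of α and β of equal length.
  lam₂ : (List D → List D → ℕ → Maybe D) → (ℕ → D) → ℕ → D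
  lam₂ G α = lam (λ n l → G (applyUpTo α (length l)) l n)

  lam₁₂ : (List D → List D → ℕ → Maybe D) → ℕ → D
  lam₁₂ G = lam (λ x la → delay (length la) (λ n l → G (take (length l) la) l n) x)

  lam₁₂-app : ∀ G α → App (lam₁₂ G) α (lam₂ G α)
  lam₁₂-app G α = lam-app
    (⇒-ext (λ k x → cong (λ m → delay m (F k) x) (sym (length-applyUpTo α k)))
      (delay-⇒ (λ k n l p → cong (λ z → G z l n) (take-applyUpTo α p))))
    where
    F : ℕ → ℕ → List D → Maybe D
    F k n l = G (take (length l) (applyUpTo α k)) l n

  lam₂-app : ∀ {G α β γ} → (λ k → G (applyUpTo α k) (applyUpTo β k)) ⇒ γ → App (lam₂ G α) β γ
  lam₂-app {G} {α} {β} p = lam-app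
    (⇒-ext (λ k x → cong (λ m → G (applyUpTo α m) (applyUpTo β k) x) (sym (length-applyUpTo β k))) p)

  kᴳ : List D → List D → ℕ → Maybe D
  kᴳ la lb = lookupᵐ la

  kᴰ : ℕ → D
  kᴰ = lam₁₂ kᴳ

  sᴰ-eval : List D → List D → List D → ℕ → Maybe D
  sᴰ-eval la lb lc = appᵐ f (appᵐ f (lookupᵐ la) (lookupᵐ lc)) (appᵐ f (lookupᵐ lb) (lookupᵐ lc))
    where f = length lc

  sᴰ₃ : (α β : ℕ → D) → ℕ → D
  sᴰ₃ α β = lam (λ n l → sᴰ-eval (applyUpTo α (length l)) (applyUpTo β (length l)) l n)

  sᴰ₂ : List D → List D → ℕ → Maybe D
  sᴰ₂ la lb = delay (length lb) (λ n l → sᴰ-eval (take (length l) la) (take (length l) lb) l n)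

  sᴰ : ℕ → D
  sᴰ = lam₁₂ sᴰ₂

  sᴰ₂-app : ∀ α β → App (lam₂ sᴰ₂ α) β (sᴰ₃ α β)
  sᴰ₂-app α β = lam₂-app {sᴰ₂}
    (⇒-ext (λ k x → cong (λ m → delay m (F k) x) (sym (length-applyUpTo β k)))
      (delay-⇒ (λ k n l p →
        cong₂ (λ y z → sᴰ-eval y z l n) (take-applyUpTo α p) (take-applyUpTo β p))))
    where
    F : ℕ → ℕ → List D → Maybe D
    F k n l = sᴰ-eval (take (length l) (applyUpTo α k)) (take (length l) (applyUpTo β k)) l n

  sᴰ₃-app : ∀ {α β γ δ ε ζ} → App α γ δ → App β γ ε → App δ ε ζ → App (sᴰ₃ α β) γ ζ
  sᴰ₃-app {α} {β} {γ} p q r = lam-app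
    (⇒-ext (λ k x → cong (λ m → eval m k x) (sym (length-applyUpTo γ k)))
      (app-⇒ (app-⇒ (lookup-⇒ α) (lookup-⇒ γ) p) (app-⇒ (lookup-⇒ β) (lookup-⇒ γ) q) r))
    where
    eval : ℕ → ℕ → ℕ → Maybe D
    eval m k = appᵐ m (appᵐ m (lookupᵐ (applyUpTo α m)) (lookupᵐ (applyUpTo γ k)))
                      (appᵐ m (lookupᵐ (applyUpTo β m)) (lookupᵐ (applyUpTo γ k)))

  toPCA : (_·_↦_ : (α β γ : ℕ → D) → Set) → (∀ α β γ → α · β ↦ γ ⇔ App α β γ) → PCA 0ℓ 0ℓ
  toPCA _·_↦_ iff = record
    { Carrier       = ℕ → D
    ; _≈_           = _≗_
    ; isEquivalence = record
        { refl = λ _ → refl ; sym = λ p x → sym (p x) ; trans = λ p q x → trans (p x) (q x) }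
    ; _·_↦_         = _·_↦_
    ; ·-resp-≈      = λ {x} p q r h → ← (App-resp {x} p q r (⟶ h))
    ; ·-functional  = λ {x} h h′ → App-functional {x} (⟶ h) (⟶ h′)
    ; k             = kᴰ
    ; s             = sᴰ
    ; k-law         = λ α β → _ , ← (lam₁₂-app kᴳ α) , ← (lam₂-app {kᴳ} {α} (lookup-⇒ α))
    ; s-defined     = λ α β → _ , _ , ← (lam₁₂-app sᴰ₂ α) , ← (sᴰ₂-app α β)
    ; s-law         = λ {α} {β} {γ} p q r → _ , _ ,
        ← (lam₁₂-app sᴰ₂ α) , ← (sᴰ₂-app α β) , ← (sᴰ₃-app {α} {β} {γ} (⟶ p) (⟶ q) (⟶ r))
    }
    where
    ⟶ : ∀ {α β γ} → α · β ↦ γ → App α β γ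
    ⟶ = Equivalence.to (iff _ _ _)
    ← : ∀ {α β γ} → App α β γ → α · β ↦ γ
    ← = Equivalence.from (iff _ _ _)

module Models (pairing : (ℕ × ℕ) ↔ ℕ) (coding : List ℕ ↪ ℕ) where

  open Inverse pairing using ()
    renaming (to to pair; from to unpair; strictlyInverseʳ to unpair-pair)
  open Application coding

  stepᴷ : ℕ → ℕ → Maybe ℕ
  stepᴷ zero    _ = nothing
  stepᴷ (suc v) _ = just v

  emitᴷ : Maybe ℕ → Maybe ℕ → ℕ
  emitᴷ _ = maybe suc 0

  stepᶜ : Fin 2 → Fin 2 → Maybe (Fin 2)
  stepᶜ 0F _ = nothing
  stepᶜ 1F w = just w

  emitᶜ : Maybe (Fin 2) → Maybe (Fin 2) → Fin 2
  emitᶜ (just v) _        = v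
  emitᶜ nothing  (just _) = 1F
  emitᶜ nothing  nothing  = 0F

  toBit : ℕ → Fin 2
  toBit zero    = 0F
  toBit (suc _) = 1F

  toBit-toℕ : ∀ d → toBit (toℕ d) ≡ d
  toBit-toℕ 0F = refl
  toBit-toℕ 1F = refl

  Fin2↪ℕ : Fin 2 ↪ ℕ
  Fin2↪ℕ = mk↪ {to = toℕ} {from = toBit} (λ { refl → toBit-toℕ _ })

  module K = Scheme coding {ℕ} (↪-id ℕ) stepᴷ emitᴷ (λ _ _ → refl) (λ _ → refl)
  module C = Scheme coding {Fin 2} Fin2↪ℕ stepᶜ emitᶜ (λ _ _ → refl) (λ _ → refl)

  AppK₂⇔ : ∀ α β γ → AppK₂ α β γ ⇔ K.App α β γ
  AppK₂⇔ α β γ = mk⇔ (λ h n → there n (h n)) (λ h n → back n (h n))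
    where
    pos : ∀ {u v} w → u > 0 → v ≡ u ∸ 1 → stepᴷ u w ≡ just v
    pos _ (s≤s _) refl = refl
    neg : ∀ {u} w → (u > 0 → ⊥) → stepᴷ u w ≡ nothing
    neg {zero}  _ _ = refl
    neg {suc u} _ p = contradiction z<s p
    pos⁻ : ∀ {u v} w → stepᴷ u w ≡ just v → u > 0 × v ≡ u ∸ 1
    pos⁻ {suc u} _ refl = z<s , refl
    neg⁻ : ∀ {u} w → stepᴷ u w ≡ nothing → u > 0 → ⊥
    neg⁻ {zero} _ _ ()
    next : ℕ → ℕ → ℕ
    next n k = K.query α β n (suc k)
    Atᴷ : ℕ → Set
    Atᴷ n = ∃[ k ] (Least (λ k → α [ n ⨾ β ↾ k ] > 0) k × γ n ≡ α [ n ⨾ β ↾ k ] ∸ 1)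
    there : ∀ n → Atᴷ n → Halts (K.stage α β n) (γ n)
    there n (k , (p , l) , e) = k , pos (next n k) p e , λ j j<k → neg (next n j) (λ q → <⇒≱ j<k (l j q))
    back : ∀ n → Halts (K.stage α β n) (γ n) → Atᴷ n
    back n (k , e , l) = let (p , q) = pos⁻ (next n k) e in
      k , (p , λ j p′ → ≮⇒≥ (λ j<k → neg⁻ (next n j) (l j j<k) p′)) , q

  App2^ω⇔ : ∀ α β γ → App2^ω α β γ ⇔ C.App α β γ
  App2^ω⇔ α β γ = mk⇔ (λ h n → there n (h n)) (λ h n → back n (h n))
    where
    pos : ∀ {u w v} → u ≡ 1F → v ≡ w → stepᶜ u w ≡ just v
    pos refl refl = refl
    neg : ∀ {u w} → (u ≡ 1F → ⊥) → stepᶜ u w ≡ nothing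
    neg {0F} _ = refl
    neg {1F} p = contradiction refl p
    pos⁻ : ∀ {u w v} → stepᶜ u w ≡ just v → u ≡ 1F × v ≡ w
    pos⁻ {1F} refl = refl , refl
    neg⁻ : ∀ {u w} → stepᶜ u w ≡ nothing → u ≡ 1F → ⊥
    neg⁻ {1F} ()
    Atᶜ : ℕ → Set
    Atᶜ n = ∃[ k ] (Least (λ k → α [ n ⨾ toℕ ∘ β ↾ k ] ≡ 1F) k × γ n ≡ α [ n ⨾ toℕ ∘ β ↾ suc k ])
    there : ∀ n → Atᶜ n → Halts (C.stage α β n) (γ n)
    there n (k , (p , l) , e) = k , pos p e , λ j j<k → neg (λ q → <⇒≱ j<k (l j q))
    back : ∀ n → Halts (C.stage α β n) (γ n) → Atᶜ n
    back n (k , e , l) = let (p , q) = pos⁻ e in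
      k , (p , λ j p′ → ≮⇒≥ (λ j<k → neg⁻ (l j j<k) p′)) , q

  K₂ : PCA 0ℓ 0ℓ
  K₂ = K.toPCA AppK₂ AppK₂⇔

  2^ω : PCA 0ℓ 0ℓ
  2^ω = C.toPCA App2^ω App2^ω⇔

  ⌊_⌋₂ : {P : Set} → Dec P → Fin 2
  ⌊ yes _ ⌋₂ = 1F
  ⌊ no  _ ⌋₂ = 0F

  -- The value at p = [n,m], read off by unpairing p.
  ε₀ : (ℕ → ℕ) → (ℕ → Fin 2)
  ε₀ α p = let (n , m) = unpair p in ⌊ α n ≟ m ⌋₂

  ζ₀ : (ℕ → Fin 2) → (ℕ → ℕ)
  ζ₀ α n = toℕ (α n)

  bind-⇒ : {X Y : Set} {A : ℕ → ℕ → Maybe X} {α : ℕ → X} (i : ℕ → ℕ) (g : ℕ → X → Y) → A ⇒ α →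
           (λ k x → A k (i x) >>= λ v → just (g x v)) ⇒ (λ x → g x (α (i x)))
  bind-⇒ i g a = record
    { sound = λ k x → ⊑-fun (g x) (sound a k (i x))
    ; conv  = λ x → ev-map (λ k e → ≡-bind _ e refl) (conv a (i x))
    }

  ⇒-≗ : {X : Set} {A : ℕ → ℕ → Maybe X} {α α′ : ℕ → X} → α ≗ α′ → A ⇒ α → A ⇒ α′
  ⇒-≗ e a = record
    { sound = λ k x → subst (_ ⊑_) (e x) (sound a k x)
    ; conv  = λ x → ev-map (λ k p → trans p (cong just (e x))) (conv a x)
    }

  εᵐ : (ℕ → Maybe ℕ) → ℕ → Maybe (Fin 2)
  εᵐ A p = A (proj₁ (unpair p)) >>= λ v → just ⌊ v ≟ proj₂ (unpair p) ⌋₂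

  ε-⇒ : ∀ {A α} → A ⇒ α → (λ k → εᵐ (A k)) ⇒ ε₀ α
  ε-⇒ = bind-⇒ (proj₁ ∘ unpair) (λ p v → ⌊ v ≟ proj₂ (unpair p) ⌋₂)

  found : ℕ → Fin 2 → Maybe ℕ
  found m 0F = nothing
  found m 1F = just m

  ε⁻¹ᵐ : ℕ → (ℕ → Maybe (Fin 2)) → ℕ → Maybe ℕ
  ε⁻¹ᵐ f A n = run f (λ m → A (pair (n , m)) >>= λ b → just (found m b))

  ε⁻¹-⇒ : ∀ {A} α → A ⇒ ε₀ α → (λ k → ε⁻¹ᵐ k (A k)) ⇒ α
  ε⁻¹-⇒ α a = run-⇒ (λ n → bind-⇒ (λ m → pair (n , m)) found a) (λ n → α n , hit n , miss n)
    where
    hit : ∀ n → found (α n) (ε₀ α (pair (n , α n))) ≡ just (α n)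
    hit n rewrite unpair-pair (n , α n) with α n ≟ α n
    ... | yes _ = refl
    ... | no ¬e = contradiction refl ¬e
    miss : ∀ n m → m < α n → found m (ε₀ α (pair (n , m))) ≡ nothing
    miss n m m< rewrite unpair-pair (n , m) with α n ≟ m
    ... | yes e = contradiction (≤-reflexive e) (<⇒≱ m<)
    ... | no  _ = refl

  ζᵐ : (ℕ → Maybe (Fin 2)) → ℕ → Maybe ℕ
  ζᵐ A n = A n >>= λ b → just (toℕ b)

  ζ-⇒ : ∀ {A α} → A ⇒ α → (λ k → ζᵐ (A k)) ⇒ ζ₀ α
  ζ-⇒ = bind-⇒ id (λ _ → toℕ)

  ζ⁻¹ᵐ : (ℕ → Maybe ℕ) → ℕ → Maybe (Fin 2)
  ζ⁻¹ᵐ A n = A n >>= λ v → just (toBit v)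

  ζ⁻¹-⇒ : ∀ {A} α → A ⇒ ζ₀ α → (λ k → ζ⁻¹ᵐ (A k)) ⇒ α
  ζ⁻¹-⇒ α a = ⇒-≗ (λ n → toBit-toℕ (α n)) (bind-⇒ id (λ _ → toBit) a)

  ε-eval : ℕ → List (Fin 2) → List (Fin 2) → ℕ → Maybe (Fin 2)
  ε-eval f la lb = εᵐ (K.appᵐ f (ε⁻¹ᵐ f (lookupᵐ la)) (ε⁻¹ᵐ f (lookupᵐ lb)))

  ε-code : List (Fin 2) → List (Fin 2) → ℕ → Maybe (Fin 2)
  ε-code la lb = ε-eval (length lb) la lb

  ζ-eval : ℕ → List ℕ → List ℕ → ℕ → Maybe ℕ
  ζ-eval f la lb = ζᵐ (C.appᵐ f (ζ⁻¹ᵐ (lookupᵐ la)) (ζ⁻¹ᵐ (lookupᵐ lb)))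

  ζ-code : List ℕ → List ℕ → ℕ → Maybe ℕ
  ζ-code la lb = ζ-eval (length lb) la lb

  ε-app : ∀ α β γ → AppK₂ α β γ → C.App (C.lam₂ ε-code (ε₀ α)) (ε₀ β) (ε₀ γ)
  ε-app α β γ h = C.lam₂-app {ε-code} {ε₀ α} (C.⇒-ext
    (λ k x → cong (λ f → ε-eval f (applyUpTo (ε₀ α) k) (applyUpTo (ε₀ β) k) x)
                  (sym (length-applyUpTo (ε₀ β) k)))
    (ε-⇒ (K.app-⇒ (ε⁻¹-⇒ α (lookup-⇒ (ε₀ α))) (ε⁻¹-⇒ β (lookup-⇒ (ε₀ β)))
                  (Equivalence.to (AppK₂⇔ α β γ) h))))

  ζ-app : ∀ α β γ → App2^ω α β γ → K.App (K.lam₂ ζ-code (ζ₀ α)) (ζ₀ β) (ζ₀ γ)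
  ζ-app α β γ h = K.lam₂-app {ζ-code} {ζ₀ α} (K.⇒-ext
    (λ k x → cong (λ f → ζ-eval f (applyUpTo (ζ₀ α) k) (applyUpTo (ζ₀ β) k) x)
                  (sym (length-applyUpTo (ζ₀ β) k)))
    (ζ-⇒ (C.app-⇒ (ζ⁻¹-⇒ α (lookup-⇒ (ζ₀ α))) (ζ⁻¹-⇒ β (lookup-⇒ (ζ₀ β)))
                  (Equivalence.to (App2^ω⇔ α β γ) h))))

  ε : ApplicativeMorphism K₂ 2^ω 0ℓ
  ε = fromFunction ε₀ (λ e p → cong (λ v → ⌊ v ≟ proj₂ (unpair p) ⌋₂) (e _))
    (C.lam₁₂ ε-code , λ α β γ h → C.lam₂ ε-code (ε₀ α) ,
      Equivalence.from (App2^ω⇔ (C.lam₁₂ ε-code) (ε₀ α) _) (C.lam₁₂-app ε-code (ε₀ α)) ,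
      Equivalence.from (App2^ω⇔ (C.lam₂ ε-code (ε₀ α)) (ε₀ β) (ε₀ γ)) (ε-app α β γ h))

  ζ : ApplicativeMorphism 2^ω K₂ 0ℓ
  ζ = fromFunction ζ₀ (λ e n → cong toℕ (e n))
    (K.lam₁₂ ζ-code , λ α β γ h → K.lam₂ ζ-code (ζ₀ α) ,
      Equivalence.from (AppK₂⇔ (K.lam₁₂ ζ-code) (ζ₀ α) _) (K.lam₁₂-app ζ-code (ζ₀ α)) ,
      Equivalence.from (AppK₂⇔ (K.lam₂ ζ-code (ζ₀ α)) (ζ₀ β) (ζ₀ γ)) (ζ-app α β γ h))

{-# OPTIONS --safe #-}
-- All four comparisons are realized by computable transformations: values of
-- ε₀ α and ζ₀ α are determined by single values of α, ζ₀ is inverted bit by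
-- bit, and α(n) is recovered from ε₀ α by searching for the least m with
-- ε₀ α [n,m] = 1.  On a prefix of the argument of length k the search is cut
-- off after k steps, so that it terminates even without an answer.
module Submission where

open import Defs
open import Data.Fin.Base using (Fin)
open import Data.List.Base using (List; applyUpTo; length)
open import Data.List.Properties using (length-applyUpTo)
open import Data.Maybe.Base using (Maybe)
open import Data.Nat.Base using (ℕ)
open import Data.Product.Base using (_×_; _,_)
open import Function.Bundles using (_↔_; _↪_; module Equivalence)
open import Relation.Binary.PropositionalEquality using (refl; trans; cong)

module _ {X Y : Set} (G : ℕ → (ℕ → Maybe X) → ℕ → Maybe Y) where

  -- The length of the prefix doubles as the fuel for the searches in `G`.
  onPrefix : ℕ → List X → Maybe Y
  onPrefix n l = G (length l) (lookupᵐ l) n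

  onPrefix-⇒ : ∀ {β : ℕ → X} {γ : ℕ → Y} → (λ k → G k (lookupᵐ (applyUpTo β k))) ⇒ γ →
               (λ k n → onPrefix n (applyUpTo β k)) ⇒ γ
  onPrefix-⇒ {β} g = record
    { sound = λ k n → eq k n (sound g k n)
    ; conv  = λ n → ev-map (λ k → trans (cong (at k n) (length-applyUpTo β k))) (conv g n)
    }
    where
    -- Isolates the fuel, so that replacing the length by `k` leaves the prefix itself fixed.
    at : ℕ → ℕ → ℕ → Maybe Y
    at k n f = G f (lookupᵐ (applyUpTo β k)) n
    eq : ∀ k n {v} → at k n k ⊑ v → at k n (length (applyUpTo β k)) ⊑ v
    eq k n p rewrite length-applyUpTo β k = p

module _ (pairing : (ℕ × ℕ) ↔ ℕ) (coding : List ℕ ↪ ℕ) where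
  open Application coding
  open Models pairing coding

  -- The realizer is built from `G` alone, so one element serves all `β` and `γ`, as `≼` demands.
  K₂-transform : ∀ G {β γ} → (λ k → G k (lookupᵐ (applyUpTo β k))) ⇒ γ →
                 AppK₂ (K.lam (onPrefix G)) β γ
  K₂-transform G {β} {γ} g = Equivalence.from (AppK₂⇔ (K.lam (onPrefix G)) β γ)
    (K.lam-app {onPrefix G} {β} (onPrefix-⇒ G g))

  2^ω-transform : ∀ G {β γ} → (λ k → G k (lookupᵐ (applyUpTo β k))) ⇒ γ →
                  App2^ω (C.lam (onPrefix G)) β γ
  2^ω-transform G {β} {γ} g = Equivalence.from (App2^ω⇔ (C.lam (onPrefix G)) β γ)
    (C.lam-app {onPrefix G} {β} (onPrefix-⇒ G g))

  ζ∘ε≼id : (ζ ∘ᵐ ε) ≼ idᵐ K₂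
  ζ∘ε≼id = K.lam (onPrefix G) , λ α β (δ , δ≈ , β≈) →
    α ,
    -- Read from the inside: `β` is `ζ₀ δ` and `δ` is `ε₀ α` pointwise, so the codings are undone in
    -- reverse order.
    K₂-transform G (ε⁻¹-⇒ α (⇒-≗ δ≈ (ζ⁻¹-⇒ δ (⇒-≗ β≈ (lookup-⇒ β))))) ,
    λ _ → refl
    where
    G : ℕ → (ℕ → Maybe ℕ) → ℕ → Maybe ℕ
    G f B = ε⁻¹ᵐ f (ζ⁻¹ᵐ B)

  id≼ζ∘ε : idᵐ K₂ ≼ (ζ ∘ᵐ ε)
  id≼ζ∘ε = K.lam (onPrefix G) , λ α β β≈ →
    ζ₀ (ε₀ α) ,
    -- An output value appears as soon as the prefix contains the one value of `β` it depends on.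
    K₂-transform G (ζ-⇒ (ε-⇒ (⇒-≗ β≈ (lookup-⇒ β)))) ,
    ε₀ α , (λ _ → refl) , λ _ → refl
    where
    G : ℕ → (ℕ → Maybe ℕ) → ℕ → Maybe ℕ
    G _ B = ζᵐ (εᵐ B)

  ε∘ζ≼id : (ε ∘ᵐ ζ) ≼ idᵐ 2^ω
  ε∘ζ≼id = C.lam (onPrefix G) , λ α β (δ , δ≈ , β≈) →
    α ,
    -- The search recovers `δ`, whose values are the bits of `α` as numbers; `ζ⁻¹ᵐ` turns them back
    -- into bits.
    2^ω-transform G (ζ⁻¹-⇒ α (⇒-≗ δ≈ (ε⁻¹-⇒ δ (⇒-≗ β≈ (lookup-⇒ β))))) ,
    λ _ → refl
    where
    G : ℕ → (ℕ → Maybe (Fin 2)) → ℕ → Maybe (Fin 2)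
    G f B = ζ⁻¹ᵐ (ε⁻¹ᵐ f B)

  id≼ε∘ζ : idᵐ 2^ω ≼ (ε ∘ᵐ ζ)
  id≼ε∘ζ = C.lam (onPrefix G) , λ α β β≈ →
    ε₀ (ζ₀ α) ,
    2^ω-transform G (ε-⇒ (ζ-⇒ (⇒-≗ β≈ (lookup-⇒ β)))) ,
    ζ₀ α , (λ _ → refl) , λ _ → refl
    where
    G : ℕ → (ℕ → Maybe (Fin 2)) → ℕ → Maybe (Fin 2)
    G _ B = εᵐ (ζᵐ B)

proposition2p15 : (pairing : (ℕ × ℕ) ↔ ℕ) (coding : List ℕ ↪ ℕ) →
    let open Models pairing coding in
    (ζ ∘ᵐ ε) ≃ idᵐ K₂ × (ε ∘ᵐ ζ) ≃ idᵐ 2^ω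
proposition2p15 p c = (ζ∘ε≼id p c , id≼ζ∘ε p c) , (ε∘ζ≼id p c , id≼ε∘ζ p c)
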